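{- Let $\mathbb{U}$ be the Urysohn space and let $\mathbf{A},\mathbf{B}\subset\mathbb{U}$ be finite. Then for every $p\in\mathrm{Iso}_{\mathbf{A}\cap\mathbf{B}}(\mathbb{U})$ and every finite $\mathbf{C}\subseteq\mathbb{U}$ there is $q\in\langle\mathrm{Iso}_{\mathbf{A}}(\mathbb{U}),\mathrm{Iso}_{\mathbf{B}}(\mathbb{U})\rangle$ such that $q(x)=p(x)$ for all $x\in\mathbf{C}$.
   Context: The Urysohn space $\mathbb{U}$ is the unique (up to isometry) complete separable metric space into which every finite metric space embeds isometrically and in which every isometry between finite subsets extends to an isometry of $\mathbb{U}$. For $\mathbf{D}\subseteq\mathbb{U}$, $\mathrm{Iso}_{\mathbf{D}}(\mathbb{U})$ is the subgroup of isometries of $\mathbb{U}$ fixing $\mathbf{D}$ pointwise; $\langle X,Y\rangle$ is the subgroup generated by $X\cup Y$. -}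

module Defs where

open import Level using (0ℓ; _⊔_)
open import Algebra.Bundles using (Group)
open import Data.Nat as ℕ using (ℕ)
import Data.Nat.Properties as ℕₚ
open import Data.Rational as ℚ using (ℚ; 0ℚ; ½)
import Data.Rational.Properties as ℚₚ
open import Data.Rational.Solver using (module +-*-Solver)
open import Data.Product using (∃; ∃-syntax; Σ-syntax; _×_; _,_; proj₁; proj₂)
open import Data.Sum using (inj₁; inj₂)
import Data.List.Membership.Setoid as ListMembership
open import Function.Bundles using (_⇔_)
open import Function.Definitions using (StrictlySurjective)
import Function.Metric.Structures as Metric
open import Relation.Binary.Core using (Rel)
open import Relation.Binary.Bundles using (Setoid)
open import Relation.Binary.Structures using (IsEquivalence; IsPartialOrder)
open import Relation.Binary.PropositionalEquality using (_≡_; refl; sym; trans; cong; subst)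
open import Relation.Unary using (Pred; _∈_)
import Relation.Unary as Unary

------------------------------------------------------------------------
-- Real numbers: Cauchy sequences of rationals, up to null sequences

Eventually : Pred ℕ 0ℓ → Set
Eventually P = ∃[ N ] (∀ n → N ℕ.≤ n → P n)

private
  _and_ : ∀ {P Q : Pred ℕ 0ℓ} → Eventually P → Eventually Q →
          Eventually (λ n → P n × Q n)
  (M , p) and (N , q) = M ℕ.⊔ N , λ n h →
    p n (ℕₚ.≤-trans (ℕₚ.m≤m⊔n M N) h) , q n (ℕₚ.≤-trans (ℕₚ.m≤n⊔m M N) h)

  imp : ∀ {P Q : Pred ℕ 0ℓ} → (∀ n → P n → Q n) → Eventually P → Eventually Q
  imp f (N , p) = N , λ n h → f n (p n h)

  half : ∀ {ε} → 0ℚ ℚ.< ε → 0ℚ ℚ.< ½ ℚ.* ε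
  half {ε} ε>0 = ℚₚ.positive⁻¹ _ {{ℚₚ.pos*pos⇒pos ½ ε {{ℚ.positive ε>0}}}}

  halves : ∀ ε → ½ ℚ.* ε ℚ.+ ½ ℚ.* ε ≡ ε
  halves ε = trans (sym (ℚₚ.*-distribʳ-+ ε ½ ½)) (ℚₚ.*-identityˡ ε)

  ∣-∣-self : ∀ p → ℚ.∣ p ℚ.- p ∣ ≡ 0ℚ
  ∣-∣-self p = cong ℚ.∣_∣ (ℚₚ.+-inverseʳ p)

  ∣-∣-sym : ∀ p q → ℚ.∣ p ℚ.- q ∣ ≡ ℚ.∣ q ℚ.- p ∣
  ∣-∣-sym p q = trans (cong ℚ.∣_∣ (lem p q)) (ℚₚ.∣-p∣≡∣p∣ (q ℚ.- p))
    where
    open +-*-Solver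
    lem : ∀ p q → p ℚ.- q ≡ ℚ.- (q ℚ.- p)
    lem = solve 2 (λ p q → p :- q := :- (q :- p)) refl

  ∣+∣-half : ∀ {p q r ε} → r ≡ p ℚ.+ q → ℚ.∣ p ∣ ℚ.< ½ ℚ.* ε →
             ℚ.∣ q ∣ ℚ.< ½ ℚ.* ε → ℚ.∣ r ∣ ℚ.< ε
  ∣+∣-half {p} {q} {ε = ε} refl p<ε q<ε = ℚₚ.≤-<-trans (ℚₚ.∣p+q∣≤∣p∣+∣q∣ p q)
    (subst (_ ℚ.<_) (halves ε) (ℚₚ.+-mono-< p<ε q<ε))

  p≤∣p∣ : ∀ p → p ℚ.≤ ℚ.∣ p ∣
  p≤∣p∣ p with ℚₚ.≤-total 0ℚ p
  ... | inj₁ 0≤p = ℚₚ.≤-reflexive (sym (ℚₚ.0≤p⇒∣p∣≡p 0≤p))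
  ... | inj₂ p≤0 = ℚₚ.≤-trans p≤0 (ℚₚ.0≤∣p∣ p)

  telescope : ∀ p q r → p ℚ.- r ≡ (p ℚ.- q) ℚ.+ (q ℚ.- r)
  telescope = solve 3 (λ p q r → p :- r := (p :- q) :+ (q :- r)) refl
    where open +-*-Solver

  interchange : ∀ p q r s → (p ℚ.+ q) ℚ.- (r ℚ.+ s) ≡ (p ℚ.- r) ℚ.+ (q ℚ.- s)
  interchange = solve 4 (λ p q r s → (p :+ q) :- (r :+ s) := (p :- r) :+ (q :- s)) refl
    where open +-*-Solver

  sub-add : ∀ p q → q ℚ.+ (p ℚ.- q) ≡ p
  sub-add = solve 2 (λ p q → q :+ (p :- q) := p) refl
    where open +-*-Solver

  add-sub : ∀ q ε → (q ℚ.+ ε) ℚ.- q ≡ ε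
  add-sub = solve 2 (λ q ε → (q :+ ε) :- q := ε) refl
    where open +-*-Solver

  <+⇒-< : ∀ {p q ε} → p ℚ.< q ℚ.+ ε → p ℚ.- q ℚ.< ε
  <+⇒-< {q = q} {ε} h = subst (_ ℚ.<_) (add-sub q ε) (ℚₚ.+-monoˡ-< (ℚ.- q) h)

  -<⇒<+ : ∀ {p q ε} → p ℚ.- q ℚ.< ε → p ℚ.< q ℚ.+ ε
  -<⇒<+ {p} {q} h = subst (ℚ._< _) (sub-add p q) (ℚₚ.+-monoʳ-< q h)

  ∣-∣< : ∀ {p q ε} → p ℚ.- q ℚ.< ε → q ℚ.- p ℚ.< ε → ℚ.∣ p ℚ.- q ∣ ℚ.< ε
  ∣-∣< {p} {q} h k with ℚₚ.≤-total 0ℚ (p ℚ.- q)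
  ... | inj₁ 0≤ = subst (ℚ._< _) (sym (ℚₚ.0≤p⇒∣p∣≡p 0≤)) h
  ... | inj₂ ≤0 = subst (ℚ._< _) (sym (trans (∣-∣-sym p q) (ℚₚ.0≤p⇒∣p∣≡p 0≤′))) k
    where
    open +-*-Solver
    0≤′ : 0ℚ ℚ.≤ q ℚ.- p
    0≤′ = subst (0ℚ ℚ.≤_) (solve 2 (λ p q → :- (p :- q) := q :- p) refl p q)
                (ℚₚ.neg-antimono-≤ ≤0)

IsCauchyℚ : (ℕ → ℚ) → Set
IsCauchyℚ s = ∀ ε → 0ℚ ℚ.< ε →
  ∃[ N ] (∀ m n → N ℕ.≤ m → N ℕ.≤ n → ℚ.∣ s m ℚ.- s n ∣ ℚ.< ε)

record ℝ : Set where
  constructor mkℝ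
  field
    seq    : ℕ → ℚ
    cauchy : IsCauchyℚ seq

open ℝ public

infix 4 _≃_ _≤_ _<_
infixl 6 _+_

-- The relations are records rather than functions so that their arguments
-- can be inferred.

record _≃_ (x y : ℝ) : Set where
  constructor mk≃
  field
    close : ∀ ε → 0ℚ ℚ.< ε → Eventually (λ n → ℚ.∣ seq x n ℚ.- seq y n ∣ ℚ.< ε)

record _≤_ (x y : ℝ) : Set where
  constructor mk≤
  field
    below : ∀ ε → 0ℚ ℚ.< ε → Eventually (λ n → seq x n ℚ.< seq y n ℚ.+ ε)

record _<_ (x y : ℝ) : Set where
  constructor mk<
  field
    gap   : ℚ
    gap>0 : 0ℚ ℚ.< gap
    apart : Eventually (λ n → seq x n ℚ.+ gap ℚ.< seq y n)

open _≃_ public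
open _≤_ public
open _<_ public

0ℝ : ℝ
0ℝ = mkℝ (λ _ → 0ℚ) (λ ε ε>0 → 0 , λ _ _ _ _ → ε>0)

-- abstract: otherwise type checking normalises this proof term.
abstract
  +-cauchy : ∀ {s t} → IsCauchyℚ s → IsCauchyℚ t → IsCauchyℚ (λ n → s n ℚ.+ t n)
  +-cauchy {s} {t} cs ct ε ε>0 with cs (½ ℚ.* ε) (half ε>0) | ct (½ ℚ.* ε) (half ε>0)
  ... | M , p | N , q = M ℕ.⊔ N , λ m n hm hn →
    ∣+∣-half (interchange (s m) (t m) (s n) (t n))
             (p m n (l hm) (l hn)) (q m n (r hm) (r hn))
    where
    l : ∀ {k} → M ℕ.⊔ N ℕ.≤ k → M ℕ.≤ k
    l = ℕₚ.≤-trans (ℕₚ.m≤m⊔n M N)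
    r : ∀ {k} → M ℕ.⊔ N ℕ.≤ k → N ℕ.≤ k
    r = ℕₚ.≤-trans (ℕₚ.m≤n⊔m M N)

_+_ : ℝ → ℝ → ℝ
x + y = mkℝ (λ n → seq x n ℚ.+ seq y n) (+-cauchy {seq x} {seq y} (cauchy x) (cauchy y))

≃-isEquivalence : IsEquivalence _≃_
≃-isEquivalence = record
  { refl  = λ {x} → mk≃ λ ε ε>0 →
      0 , λ n _ → subst (ℚ._< ε) (sym (∣-∣-self (seq x n))) ε>0
  ; sym   = λ {x} {y} x≃y → mk≃ λ ε ε>0 →
      imp (λ n → subst (ℚ._< ε) (∣-∣-sym (seq x n) (seq y n))) (close x≃y ε ε>0)
  ; trans = λ {x} {y} {z} x≃y y≃z → mk≃ λ ε ε>0 →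
      imp (λ n (h , k) → ∣+∣-half (telescope (seq x n) (seq y n) (seq z n)) h k)
          (close x≃y _ (half ε>0) and close y≃z _ (half ε>0))
  }

≤-isPartialOrder : IsPartialOrder _≃_ _≤_
≤-isPartialOrder = record
  { isPreorder = record
    { isEquivalence = ≃-isEquivalence
    ; reflexive = λ {x} {y} x≃y → mk≤ λ ε ε>0 →
        imp (λ n h → -<⇒<+ {seq x n} {seq y n}
               (ℚₚ.≤-<-trans (p≤∣p∣ (seq x n ℚ.- seq y n)) h))
            (close x≃y ε ε>0)
    ; trans = λ {x} {y} {z} x≤y y≤z → mk≤ λ ε ε>0 →
        imp (λ n (h , k) → -<⇒<+ {seq x n} {seq z n} (subst (ℚ._< ε)
               (sym (telescope (seq x n) (seq y n) (seq z n)))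
               (subst (_ ℚ.<_) (halves ε)
                 (ℚₚ.+-mono-< (<+⇒-< {seq x n} {seq y n} h)
                              (<+⇒-< {seq y n} {seq z n} k)))))
            (below x≤y _ (half ε>0) and below y≤z _ (half ε>0))
    }
  ; antisym = λ {x} {y} x≤y y≤x → mk≃ λ ε ε>0 →
      imp (λ n (h , k) → ∣-∣< {seq x n} {seq y n} (<+⇒-< {seq x n} {seq y n} h)
                                                  (<+⇒-< {seq y n} {seq x n} k))
          (below x≤y ε ε>0 and below y≤x ε ε>0)
  }

private
  module ≃ = IsEquivalence ≃-isEquivalence

------------------------------------------------------------------------
-- Metric spaces

IsMetric : ∀ {A : Set} → Rel A 0ℓ → (A → A → ℝ) → Set
IsMetric _≈_ d = Metric.IsGeneralMetric _≈_ _≃_ _≤_ 0ℝ _+_ d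

-- Points are compared by a setoid equality _≈_, which the metric axioms
-- force to coincide with "distance zero".

record MetricSpace : Set₁ where
  infix 4 _≈_
  field
    Carrier  : Set
    _≈_      : Rel Carrier 0ℓ
    d        : Carrier → Carrier → ℝ
    isMetric : IsMetric _≈_ d

  open Metric.IsGeneralMetric isMetric public
    using (isSemiMetric; triangle; nonNegative; ≈⇒0; 0⇒≈; ≈-isEquivalence)
    renaming (sym to d-sym; cong to d-cong)

  setoid : Setoid 0ℓ 0ℓ
  setoid = record { isEquivalence = ≈-isEquivalence }

∣_∣ₘ : MetricSpace → Set
∣ M ∣ₘ = MetricSpace.Carrier M

Subspace : (M : MetricSpace) → Pred ∣ M ∣ₘ 0ℓ → MetricSpace
Subspace M D = record
  { Carrier  = ∃ D
  ; _≈_      = λ x y → proj₁ x ≈ proj₁ y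
  ; d        = λ x y → d (proj₁ x) (proj₁ y)
  ; isMetric = record
    { isSemiMetric = record
      { isQuasiSemiMetric = record
        { isPreMetric = record
          { isProtoMetric = record
            { isPartialOrder  = ≤-isPartialOrder
            ; ≈-isEquivalence = record
              { refl = Setoid.refl setoid ; sym = Setoid.sym setoid ; trans = Setoid.trans setoid }
            ; cong            = d-cong
            ; nonNegative     = nonNegative
            }
          ; ≈⇒0 = ≈⇒0
          }
        ; 0⇒≈ = 0⇒≈
        }
      ; sym = λ x y → d-sym (proj₁ x) (proj₁ y)
      }
    ; triangle = λ x y z → triangle (proj₁ x) (proj₁ y) (proj₁ z)
    }
  }
  where open MetricSpace M

Finite : (M : MetricSpace) → Pred ∣ M ∣ₘ 0ℓ → Set
Finite M D = ∃[ xs ] (∀ x → x ∈ D ⇔ x ∈ₗ xs)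
  where open ListMembership (MetricSpace.setoid M) renaming (_∈_ to _∈ₗ_)

FiniteSpace : MetricSpace → Set
FiniteSpace M = Finite M Unary.U

module _ (M : MetricSpace) where
  open MetricSpace M

  IsCauchy : (ℕ → Carrier) → Set
  IsCauchy s = ∀ ε → 0ℝ < ε →
    ∃[ N ] (∀ m n → N ℕ.≤ m → N ℕ.≤ n → d (s m) (s n) < ε)

  _ConvergesTo_ : (ℕ → Carrier) → Carrier → Set
  s ConvergesTo x = ∀ ε → 0ℝ < ε → Eventually (λ n → d (s n) x < ε)

  Complete : Set
  Complete = ∀ s → IsCauchy s → ∃[ x ] (s ConvergesTo x)

  -- This is separability for nonempty spaces; it excludes the empty space.
  Separable : Set
  Separable = Σ[ s ∈ (ℕ → Carrier) ] (∀ x ε → 0ℝ < ε → ∃[ n ] (d x (s n) < ε))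

------------------------------------------------------------------------
-- Isometries

module _ (M N : MetricSpace) where
  private
    module M = MetricSpace M
    module N = MetricSpace N

  IsIsometric : (M.Carrier → N.Carrier) → Set
  IsIsometric f = ∀ x y → N.d (f x) (f y) ≃ M.d x y

  record Embedding : Set where
    field
      to        : M.Carrier → N.Carrier
      isometric : IsIsometric to

  -- Congruence and injectivity follow from preservation of distances.
  record Isometry : Set where
    field
      to         : M.Carrier → N.Carrier
      isometric  : IsIsometric to
      surjective : StrictlySurjective N._≈_ to

    to-cong : ∀ {x y} → x M.≈ y → to x N.≈ to y
    to-cong x≈y = N.0⇒≈ (≃.trans (isometric _ _) (M.≈⇒0 x≈y))

    to-injective : ∀ {x y} → to x N.≈ to y → x M.≈ y
    to-injective e = M.0⇒≈ (≃.trans (≃.sym (isometric _ _)) (N.≈⇒0 e))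

    from : N.Carrier → M.Carrier
    from y = proj₁ (surjective y)

    to-from : ∀ y → to (from y) N.≈ y
    to-from y = proj₂ (surjective y)

infixl 20 _⟨$⟩_
_⟨$⟩_ : ∀ {M N} → Isometry M N → ∣ M ∣ₘ → ∣ N ∣ₘ
_⟨$⟩_ = Isometry.to

-- The product is composition: (f ∙ g) x = f (g x).
IsoGroup : MetricSpace → Group 0ℓ 0ℓ
IsoGroup M = record
  { Carrier = Isometry M M
  ; _≈_     = λ f g → ∀ x → f ⟨$⟩ x ≈ g ⟨$⟩ x
  ; _∙_     = λ f g → record
      { to         = λ x → f ⟨$⟩ (g ⟨$⟩ x)
      ; isometric  = λ x y → ≃.trans (isometric f _ _) (isometric g x y)
      ; surjective = λ y → from g (from f y)
                         , S.trans (to-cong f (to-from g _)) (to-from f y)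
      }
  ; ε       = record
      { to         = λ x → x
      ; isometric  = λ _ _ → ≃.refl
      ; surjective = λ y → y , S.refl
      }
  ; _⁻¹     = λ f → record
      { to         = from f
      ; isometric  = λ x y → ≃.trans (≃.sym (isometric f _ _))
                                     (d-cong (to-from f x) (to-from f y))
      ; surjective = λ y → f ⟨$⟩ y , to-injective f (to-from f _)
      }
  ; isGroup = record
      { isMonoid = record
        { isSemigroup = record
          { isMagma = record
            { isEquivalence = record
              { refl  = λ _ → S.refl
              ; sym   = λ p x → S.sym (p x)
              ; trans = λ p q x → S.trans (p x) (q x)
              }
            ; ∙-cong = λ {f} p q x → S.trans (to-cong f (q x)) (p _)
            }
          ; assoc = λ _ _ _ _ → S.refl
          }
        ; identity = (λ _ _ → S.refl) , (λ _ _ → S.refl)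
        }
      ; inverse = (λ f x → to-injective f (to-from f _)) , (λ f x → to-from f x)
      ; ⁻¹-cong = λ {f} {g} p x → to-injective f
          (S.trans (to-from f x) (S.sym (S.trans (p _) (to-from g x))))
      }
  }
  where
  open MetricSpace M
  open module I {M N} (f : Isometry M N) = Isometry f
    using (isometric; to-cong; to-injective; from; to-from)
  module S = Setoid setoid

-- Iso M D is the pointwise stabiliser of D.
Iso : (M : MetricSpace) → Pred ∣ M ∣ₘ 0ℓ → Pred (Isometry M M) 0ℓ
Iso M D f = ∀ x → x ∈ D → f ⟨$⟩ x ≈ x
  where open MetricSpace M

-- The constructor resp closes the subgroup under the group's setoid equality.
module _ {c ℓ} (G : Group c ℓ) where
  open Group G using (Carrier; _≈_; _∙_; ε; _⁻¹)

  data Generated {p} (X : Pred Carrier p) : Pred Carrier (c ⊔ ℓ ⊔ p) where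
    gen  : ∀ {g} → g ∈ X → Generated X g
    unit : Generated X ε
    mul  : ∀ {g h} → Generated X g → Generated X h → Generated X (g ∙ h)
    inv  : ∀ {g} → Generated X g → Generated X (g ⁻¹)
    resp : ∀ {g h} → g ≈ h → Generated X g → Generated X h

-- The subgroup of isometries of M generated by X ∪ Y.
⟨_,_⟩ : ∀ {M} → (X Y : Pred (Isometry M M) 0ℓ) → Pred (Isometry M M) 0ℓ
⟨_,_⟩ {M} X Y = Generated (IsoGroup M) (X Unary.∪ Y)

------------------------------------------------------------------------
-- The Urysohn space

Universal : MetricSpace → Set₁
Universal M = (F : MetricSpace) → FiniteSpace F → Embedding F M

Homogeneous : MetricSpace → Set₁
Homogeneous M = (D E : Pred ∣ M ∣ₘ 0ℓ) → Finite M D → Finite M E →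
  (f : Isometry (Subspace M D) (Subspace M E)) →
  Σ[ g ∈ Isometry M M ] ((x : ∃ D) → g ⟨$⟩ proj₁ x ≈ proj₁ (f ⟨$⟩ x))
  where
  open MetricSpace M

record IsUrysohn (M : MetricSpace) : Set₁ where
  field
    complete    : Complete M
    separable   : Separable M
    universal   : Universal M
    homogeneous : Homogeneous M

{-# OPTIONS --safe #-}
-- Write D = A ∩ B, and for a finite set X put
--   free X x y = min (R, min { d x z + d z y | z ∈ X }),
-- where R bounds all distances among A, B, C and p(C). Two copies of 𝕌 with
-- the metric truncated at R, glued along X with free X as cross distance, form
-- a pseudometric space. By universality and homogeneity, Iso_A therefore
-- contains an isometry g with d (g x) b = free A x b for all x ∈ C and b ∈ B.
--
-- Moving C alternately by such elements of Iso_A and Iso_B makes its distances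
-- to A ∪ B the minimum over ever longer alternating paths. A path avoiding D
-- gains at least δ at every move, where δ > 0 is the least nonzero distance
-- between A and B, so it exceeds R after finitely many moves. From then on the
-- distance from x to A is free D x, which depends only on the distances to D.
-- As p fixes D, the tuples C and p(C) end up with the same distances to A, so
-- an element of Iso_A carries one onto the other.
--
-- The truncation at R also covers the case D = ∅, where free D is constant R.
module Submission where

open import Defs
open import Level using (0ℓ)
open import Algebra.Bundles using (Group)
open import Axiom.ExcludedMiddle using (ExcludedMiddle)
open import Data.Fin using (Fin)
open import Data.Integer as ℤ using (+_; -[1+_])
import Data.Integer.Properties as ℤₚ
open import Data.List using (List; []; _∷_; _++_; map; filter; allFin; cartesianProduct; length; lookup)
import Data.List.Extrema as Extrema
open import Data.List.Membership.Propositional using (lose) renaming (_∈_ to _∈ₗ_)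
open import Data.List.Membership.Propositional.Properties using (∈-map⁺; ∈-map⁻; ∈-++⁺ˡ; ∈-++⁺ʳ; ∈-allFin; ∈-cartesianProduct⁺; ∈-filter⁺; ∈-filter⁻; ∈-lookup)
import Data.List.Membership.Setoid as SetoidMembership
import Data.List.Relation.Unary.All as All
open import Data.List.Relation.Unary.Any as Any using (here; there)
import Data.List.Relation.Unary.Any.Properties as Anyₚ
import Data.Nat.Coprimality as Coprime
open import Data.Nat as ℕ using (ℕ; zero; suc)
import Data.Nat.Properties as ℕₚ
open import Data.Product using (Σ-syntax; ∃-syntax; _×_; _,_; proj₁; proj₂; map₂)
open import Data.Rational as ℚ using (ℚ; 0ℚ; 1ℚ; ½)
import Data.Rational.Properties as ℚₚ
open import Data.Rational.Solver using (module +-*-Solver)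
import Data.Rational.Unnormalised as ℚᵘ
import Data.Rational.Unnormalised.Properties as ℚᵘₚ
open import Data.Sum using (_⊎_; inj₁; inj₂; [_,_]; fromInj₁) renaming (map to ⊎-map)
open import Data.Unit using (tt)
open import Function using (_∘_; id; case_of_)
open import Function.Bundles using (_⇔_; mk⇔; Equivalence)
open import Relation.Binary.Bundles using (Poset; Setoid; TotalOrder)
open import Relation.Binary.PropositionalEquality as ≡ using (_≡_)
import Relation.Binary.Reasoning.PartialOrder as PosetReasoning
open import Relation.Binary.Structures using (IsEquivalence; IsPartialOrder)
open import Relation.Nullary using (Dec; yes; no; contradiction)
open import Relation.Unary using (Pred; _∈_; _∩_)

-- Real numbers

map-eventually : ∀ {P Q : Pred ℕ 0ℓ} → (∀ n → P n → Q n) → Eventually P → Eventually Q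
map-eventually f (N , p) = N , λ n N≤n → f n (p n N≤n)

both-eventually : ∀ {P Q : Pred ℕ 0ℓ} → Eventually P → Eventually Q → Eventually (λ n → P n × Q n)
both-eventually (M , p) (N , q) = M ℕ.⊔ N , λ n h →
  p n (ℕₚ.≤-trans (ℕₚ.m≤m⊔n M N) h) , q n (ℕₚ.≤-trans (ℕₚ.m≤n⊔m M N) h)

½*-pos : ∀ {ε} → 0ℚ ℚ.< ε → 0ℚ ℚ.< ½ ℚ.* ε
½*-pos {ε} ε>0 = ℚₚ.positive⁻¹ _ {{ℚₚ.pos*pos⇒pos ½ ε {{ℚ.positive ε>0}}}}

p≤∣p∣ : ∀ p → p ℚ.≤ ℚ.∣ p ∣
p≤∣p∣ p with ℚₚ.≤-total 0ℚ p
... | inj₁ 0≤p = ℚₚ.≤-reflexive (≡.sym (ℚₚ.0≤p⇒∣p∣≡p 0≤p))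
... | inj₂ p≤0 = ℚₚ.≤-trans p≤0 (ℚₚ.0≤∣p∣ p)

∣p-q∣<ε⇒p<q+ε : ∀ p q {ε} → ℚ.∣ p ℚ.- q ∣ ℚ.< ε → p ℚ.< q ℚ.+ ε
∣p-q∣<ε⇒p<q+ε p q h = ≡.subst (ℚ._< _) (lem p q)
  (ℚₚ.+-monoʳ-< q (ℚₚ.≤-<-trans (p≤∣p∣ (p ℚ.- q)) h))
  where
  open +-*-Solver
  lem : ∀ p q → q ℚ.+ (p ℚ.- q) ≡ p
  lem = solve 2 (λ p q → q :+ (p :- q) := p) ≡.refl

p<p+q : ∀ p {q} → 0ℚ ℚ.< q → p ℚ.< p ℚ.+ q
p<p+q p {q} q>0 = ≡.subst (ℚ._< p ℚ.+ q) (ℚₚ.+-identityʳ p) (ℚₚ.+-monoʳ-< p q>0)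

ℝ-poset : Poset 0ℓ 0ℓ 0ℓ
ℝ-poset = record { isPartialOrder = ≤-isPartialOrder }

module ≤ = IsPartialOrder ≤-isPartialOrder
module ≃ = IsEquivalence ≃-isEquivalence

abstract
  -- Reals with equal sequences may still carry different Cauchy proofs, so the laws of ℚ transfer
  -- only up to `≃`, through two inequalities of this kind.
  ≤-termwise : ∀ {x y} → (∀ n → seq x n ≡ seq y n) → x ≤ y
  ≤-termwise {x} {y} eq = mk≤ λ ε ε>0 → 0 , λ n _ →
    ≡.subst (ℚ._< seq y n ℚ.+ ε) (≡.sym (eq n)) (p<p+q (seq y n) ε>0)

  +-comm : ∀ x y → x + y ≃ y + x
  +-comm x y = ≤.antisym (≤-termwise λ n → ℚₚ.+-comm (seq x n) (seq y n))
                         (≤-termwise λ n → ℚₚ.+-comm (seq y n) (seq x n))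

  +-assoc : ∀ x y z → (x + y) + z ≃ x + (y + z)
  +-assoc x y z = ≤.antisym
    (≤-termwise λ n → ℚₚ.+-assoc (seq x n) (seq y n) (seq z n))
    (≤-termwise λ n → ≡.sym (ℚₚ.+-assoc (seq x n) (seq y n) (seq z n)))

  +-identityʳ : ∀ x → x + 0ℝ ≃ x
  +-identityʳ x = ≤.antisym (≤-termwise λ n → ℚₚ.+-identityʳ (seq x n))
                            (≤-termwise λ n → ≡.sym (ℚₚ.+-identityʳ (seq x n)))

  +-mono-≤ : ∀ {x y u v} → x ≤ y → u ≤ v → x + u ≤ y + v
  +-mono-≤ {x} {y} {u} {v} x≤y u≤v = mk≤ λ ε ε>0 →
    map-eventually
      (λ n (h , k) → ≡.subst (_ ℚ.<_) (rearrange (seq y n) (seq v n) ε) (ℚₚ.+-mono-< h k))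
      (both-eventually (below x≤y _ (½*-pos ε>0)) (below u≤v _ (½*-pos ε>0)))
    where
    open +-*-Solver
    rearrange : ∀ p q ε → (p ℚ.+ ½ ℚ.* ε) ℚ.+ (q ℚ.+ ½ ℚ.* ε) ≡ (p ℚ.+ q) ℚ.+ ε
    rearrange = solve 3 (λ p q ε →
      (p :+ con ½ :* ε) :+ (q :+ con ½ :* ε) := (p :+ q) :+ ε) ≡.refl

  <⇒≤ : ∀ {x y} → x < y → x ≤ y
  <⇒≤ {x} {y} (mk< g g>0 apart) = mk≤ λ ε ε>0 → map-eventually
    (λ n h → ℚₚ.<-trans (ℚₚ.<-trans (p<p+q (seq x n) g>0) h) (p<p+q (seq y n) ε>0)) apart

  -- The Cauchy moduli of x and y at precision η reduce the question to
  -- comparing x N with y N + 3η for a single N.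
  below-or-above : ∀ x y η → 0ℚ ℚ.< η →
    Eventually (λ n → seq x n ℚ.< seq y n ℚ.+ (η ℚ.+ η ℚ.+ η ℚ.+ η ℚ.+ η)) ⊎ y < x
  below-or-above x y η η>0
    with M , near-x ← cauchy x η η>0 | L , near-y ← cauchy y η η>0
    = compare (seq x N ℚₚ.<? seq y N ℚ.+ (η ℚ.+ η ℚ.+ η))
    where
    open +-*-Solver
    N : ℕ
    N = M ℕ.⊔ L
    x-step : ∀ {m n} → N ℕ.≤ m → N ℕ.≤ n → seq x m ℚ.< seq x n ℚ.+ η
    x-step {m} {n} N≤m N≤n = ∣p-q∣<ε⇒p<q+ε (seq x m) (seq x n)
      (near-x m n (ℕₚ.≤-trans (ℕₚ.m≤m⊔n M L) N≤m) (ℕₚ.≤-trans (ℕₚ.m≤m⊔n M L) N≤n))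
    y-step : ∀ {m n} → N ℕ.≤ m → N ℕ.≤ n → seq y m ℚ.< seq y n ℚ.+ η
    y-step {m} {n} N≤m N≤n = ∣p-q∣<ε⇒p<q+ε (seq y m) (seq y n)
      (near-y m n (ℕₚ.≤-trans (ℕₚ.m≤n⊔m M L) N≤m) (ℕₚ.≤-trans (ℕₚ.m≤n⊔m M L) N≤n))
    collect : ∀ p η → ((p ℚ.+ η) ℚ.+ (η ℚ.+ η ℚ.+ η)) ℚ.+ η ≡ p ℚ.+ (η ℚ.+ η ℚ.+ η ℚ.+ η ℚ.+ η)
    collect = solve 2 (λ p η →
      ((p :+ η) :+ (η :+ η :+ η)) :+ η := p :+ (η :+ η :+ η :+ η :+ η)) ≡.refl
    cancelˡ : ∀ p η → (p ℚ.+ (η ℚ.+ η ℚ.+ η)) ℚ.- (η ℚ.+ η) ≡ p ℚ.+ η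
    cancelˡ = solve 2 (λ p η → (p :+ (η :+ η :+ η)) :- (η :+ η) := p :+ η) ≡.refl
    swap : ∀ p q r → (p ℚ.+ q) ℚ.+ r ≡ (p ℚ.+ r) ℚ.+ q
    swap = solve 3 (λ p q r → (p :+ q) :+ r := (p :+ r) :+ q) ≡.refl
    cancelʳ : ∀ p η → ((p ℚ.+ η) ℚ.+ η) ℚ.- (η ℚ.+ η) ≡ p
    cancelʳ = solve 2 (λ p η → ((p :+ η) :+ η) :- (η :+ η) := p) ≡.refl
    compare : Dec (seq x N ℚ.< seq y N ℚ.+ (η ℚ.+ η ℚ.+ η)) →
      Eventually (λ n → seq x n ℚ.< seq y n ℚ.+ (η ℚ.+ η ℚ.+ η ℚ.+ η ℚ.+ η)) ⊎ y < x
    compare (yes h) = inj₁ (N , λ n N≤n → begin-strict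
      seq x n                                               <⟨ x-step N≤n ℕₚ.≤-refl ⟩
      seq x N ℚ.+ η                                         <⟨ ℚₚ.+-monoˡ-< η h ⟩
      (seq y N ℚ.+ (η ℚ.+ η ℚ.+ η)) ℚ.+ η
        <⟨ ℚₚ.+-monoˡ-< η (ℚₚ.+-monoˡ-< (η ℚ.+ η ℚ.+ η) (y-step ℕₚ.≤-refl N≤n)) ⟩
      ((seq y n ℚ.+ η) ℚ.+ (η ℚ.+ η ℚ.+ η)) ℚ.+ η           ≡⟨ collect (seq y n) η ⟩
      seq y n ℚ.+ (η ℚ.+ η ℚ.+ η ℚ.+ η ℚ.+ η)               ∎)
      where open ℚₚ.≤-Reasoning
    compare (no ¬h) = inj₂ (mk< η η>0 (N , λ n N≤n →
      ≡.subst₂ ℚ._<_ (cancelˡ (seq y n) η) (cancelʳ (seq x n) η)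
        (ℚₚ.+-monoˡ-< (ℚ.- (η ℚ.+ η)) (begin-strict
          seq y n ℚ.+ (η ℚ.+ η ℚ.+ η)
            <⟨ ℚₚ.+-monoˡ-< (η ℚ.+ η ℚ.+ η) (y-step N≤n ℕₚ.≤-refl) ⟩
          (seq y N ℚ.+ η) ℚ.+ (η ℚ.+ η ℚ.+ η)  ≡⟨ swap (seq y N) η (η ℚ.+ η ℚ.+ η) ⟩
          (seq y N ℚ.+ (η ℚ.+ η ℚ.+ η)) ℚ.+ η  ≤⟨ ℚₚ.+-monoˡ-≤ η (ℚₚ.≮⇒≥ ¬h) ⟩
          seq x N ℚ.+ η                        <⟨ ℚₚ.+-monoˡ-< η (x-step ℕₚ.≤-refl N≤n) ⟩
          (seq x n ℚ.+ η) ℚ.+ η                ∎))))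
      where open ℚₚ.≤-Reasoning

  -- Excluded middle is asked once, about `x < y`, before any precision is given. If the answer is
  -- no, `below-or-above` must return its first alternative at every precision; η is one fifth of ε
  -- because that alternative carries the error 5η.
  <-or-≥ : ExcludedMiddle 0ℓ → ∀ x y → x < y ⊎ y ≤ x
  <-or-≥ em x y with em {x < y}
  ... | yes x<y = inj₁ x<y
  ... | no x≮y = inj₂ (mk≤ λ ε ε>0 → ≡.subst (λ e → Eventually (λ n → seq y n ℚ.< seq x n ℚ.+ e))
    (fifths ε) (fromInj₁ (λ x<y → contradiction x<y x≮y) (below-or-above y x (⅕ ℚ.* ε)
      (ℚₚ.positive⁻¹ _ {{ℚₚ.pos*pos⇒pos ⅕ ε {{ℚ.positive ε>0}}}}))))
    where
    open +-*-Solver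
    ⅕ : ℚ
    ⅕ = + 1 ℚ./ 5
    fifths : ∀ ε → ⅕ ℚ.* ε ℚ.+ ⅕ ℚ.* ε ℚ.+ ⅕ ℚ.* ε ℚ.+ ⅕ ℚ.* ε ℚ.+ ⅕ ℚ.* ε ≡ ε
    fifths = solve 1 (λ ε → con ⅕ :* ε :+ con ⅕ :* ε :+ con ⅕ :* ε :+ con ⅕ :* ε :+ con ⅕ :* ε := ε) ≡.refl

  const : ℚ → ℝ
  const p = mkℝ (λ _ → p) λ ε ε>0 → 0 , λ _ _ _ _ →
    ≡.subst (ℚ._< ε) (≡.sym (≡.cong ℚ.∣_∣ (ℚₚ.+-inverseʳ p))) ε>0

  bounded : ∀ x → ∃[ p ] x ≤ const p
  bounded x with N , near ← cauchy x 1ℚ (ℚₚ.positive⁻¹ 1ℚ) = seq x N ℚ.+ 1ℚ , mk≤ λ ε ε>0 →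
    N , λ n N≤n → ℚₚ.<-trans
      (∣p-q∣<ε⇒p<q+ε (seq x n) (seq x N) (near n N N≤n ℕₚ.≤-refl)) (p<p+q _ ε>0)

  -- Puts a positive rational below a positive real, which reduces the Archimedean property to ℚ.
  const-gap : ∀ {x} (0<x : 0ℝ < x) → const (gap 0<x) ≤ x
  const-gap {x} (mk< g g>0 apart) = mk≤ λ ε ε>0 → map-eventually
    (λ n h → ℚₚ.<-trans (≡.subst (ℚ._< seq x n) (ℚₚ.+-identityˡ g) h) (p<p+q (seq x n) ε>0)) apart

  const-mono : ∀ {p q} → p ℚ.≤ q → const p ≤ const q
  const-mono {q = q} p≤q = mk≤ λ ε ε>0 → 0 , λ _ _ → ℚₚ.≤-<-trans p≤q (p<p+q q ε>0)

  const-+ : ∀ p q → const (p ℚ.+ q) ≤ const p + const q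
  const-+ p q = ≤-termwise λ _ → ≡.refl

  const-0 : const 0ℚ ≤ 0ℝ
  const-0 = ≤-termwise λ _ → ≡.refl

  0<1 : 0ℝ < const 1ℚ
  0<1 = mk< ½ (ℚₚ.positive⁻¹ ½) (0 , λ _ _ → ℚ.*<* (ℤ.+<+ (ℕ.s≤s (ℕ.s≤s ℕ.z≤n))))

-- Natural multiples and the Archimedean property

infixr 7 _·_
_·_ : ℕ → ℝ → ℝ
zero  · x = 0ℝ
suc n · x = x + n · x

-- Given directly in lowest terms, the 0 encoding the denominator 1, so that no gcd normalisation
-- blocks reduction.
fromℕ : ℕ → ℚ
fromℕ n = ℚ.mkℚ (+ n) 0 (Coprime.sym (Coprime.1-coprimeTo n))

abstract
  -- The sum in ℚ is normalised, so the comparison is made among unnormalised rationals, where it is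
  -- an identity of integers.
  fromℕ-suc : ∀ n → fromℕ (suc n) ℚ.≤ 1ℚ ℚ.+ fromℕ n
  fromℕ-suc n = ℚₚ.toℚᵘ-cancel-≤ (ℚᵘₚ.≤-trans
    (ℚᵘₚ.≤-reflexive (ℚᵘ.*≡* (≡.cong (λ i → (ℤ.1ℤ ℤ.+ i) ℤ.* ℤ.1ℤ) (≡.sym (ℤₚ.*-identityʳ (+ n))))))
    (ℚᵘₚ.≤-reflexive (ℚᵘₚ.≃-sym (ℚₚ.toℚᵘ-homo-+ 1ℚ (fromℕ n)))))

  -- A nonnegative `p` is at most its numerator because the denominator is at least one; a negative
  -- `p` lies below every natural number.
  ≤fromℕ : ∀ p → p ℚ.≤ fromℕ ℤ.∣ ℚ.↥ p ∣
  ≤fromℕ (ℚ.mkℚ (+ n) d _)    = ℚ.*≤* (ℤₚ.*-monoˡ-≤-nonNeg (+ n) (ℤ.+≤+ (ℕ.s≤s ℕ.z≤n)))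
  ≤fromℕ (ℚ.mkℚ -[1+ n ] d _) = ℚ.*≤* ℤ.-≤+

  ℚ-archimedean : ∀ q g .{{_ : ℚ.Positive g}} → ∃[ n ] q ℚ.≤ fromℕ n ℚ.* g
  ℚ-archimedean q g = n , ≡.subst (ℚ._≤ fromℕ n ℚ.* g)
    (≡.trans (ℚₚ.*-assoc q (ℚ.1/ g) g)
      (≡.trans (≡.cong (q ℚ.*_) (ℚₚ.*-inverseˡ g)) (ℚₚ.*-identityʳ q)))
    (ℚₚ.*-monoʳ-≤-nonNeg g {{ℚₚ.pos⇒nonNeg g}} (≤fromℕ (q ℚ.* ℚ.1/ g)))
    where
    instance
      g≢0 : ℚ.NonZero g
      g≢0 = ℚₚ.pos⇒nonZero g
    n : ℕ
    n = ℤ.∣ ℚ.↥ (q ℚ.* ℚ.1/ g) ∣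

  multiple : ∀ {δ} (0<δ : 0ℝ < δ) n → const (fromℕ n ℚ.* gap 0<δ) ≤ n · δ
  multiple 0<δ zero    = ≤.trans (const-mono (ℚₚ.≤-reflexive (ℚₚ.*-zeroˡ (gap 0<δ)))) const-0
  multiple 0<δ (suc n) = ≤.trans
    (≤.trans
      (const-mono (≡.subst (fromℕ (suc n) ℚ.* gap 0<δ ℚ.≤_) (distrib (gap 0<δ) (fromℕ n))
        (ℚₚ.*-monoʳ-≤-nonNeg (gap 0<δ) {{ℚ.nonNegative (ℚₚ.<⇒≤ (gap>0 0<δ))}} (fromℕ-suc n))))
      (const-+ (gap 0<δ) (fromℕ n ℚ.* gap 0<δ)))
    (+-mono-≤ (const-gap 0<δ) (multiple 0<δ n))
    where
    open +-*-Solver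
    distrib : ∀ g p → (1ℚ ℚ.+ p) ℚ.* g ≡ g ℚ.+ p ℚ.* g
    distrib = solve 2 (λ g p → (con 1ℚ :+ p) :* g := g :+ p :* g) ≡.refl

archimedean : ∀ x {δ} → 0ℝ < δ → ∃[ n ] x ≤ n · δ
archimedean x 0<δ with q , x≤q ← bounded x
                  with n , q≤ng ← ℚ-archimedean q (gap 0<δ) {{ℚ.positive (gap>0 0<δ)}}
  = n , ≤.trans x≤q (≤.trans (const-mono q≤ng) (multiple 0<δ n))

open PosetReasoning ℝ-poset

+-cong : ∀ {x y u v} → x ≃ y → u ≃ v → x + u ≃ y + v
+-cong x≃y u≃v = ≤.antisym
  (+-mono-≤ (≤.reflexive x≃y) (≤.reflexive u≃v))
  (+-mono-≤ (≤.reflexive (≃.sym x≃y)) (≤.reflexive (≃.sym u≃v)))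

x≤x+y : ∀ x {y} → 0ℝ ≤ y → x ≤ x + y
x≤x+y x 0≤y = ≤.trans (≤.reflexive (≃.sym (+-identityʳ x))) (+-mono-≤ ≤.refl 0≤y)

x≤y+x : ∀ x {y} → 0ℝ ≤ y → x ≤ y + x
x≤y+x x 0≤y = ≤.trans (x≤x+y x 0≤y) (≤.reflexive (+-comm x _))

-- Finite configurations in homogeneous and universal spaces

-- Finite subsets are handled as families indexed by such a set: the indices are listed up to `≡`,
-- while the points they name may repeat up to `≈`.
Listing : Set → Set
Listing I = Σ[ is ∈ List I ] (∀ i → i ∈ₗ is)

listing-Fin : ∀ n → Listing (Fin n)
listing-Fin n = allFin n , ∈-allFin

infixr 1 _⊕_
_⊕_ : ∀ {I J} → Listing I → Listing J → Listing (I ⊎ J)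
(is , all-i) ⊕ (js , all-j) = map inj₁ is ++ map inj₂ js , λ where
  (inj₁ i) → ∈-++⁺ˡ (∈-map⁺ inj₁ (all-i i))
  (inj₂ j) → ∈-++⁺ʳ (map inj₁ is) (∈-map⁺ inj₂ (all-j j))

infixr 2 _⊗_
_⊗_ : ∀ {I J} → Listing I → Listing J → Listing (I × J)
(is , all-i) ⊗ (js , all-j) =
  cartesianProduct is js , λ (i , j) → ∈-cartesianProduct⁺ (all-i i) (all-j j)

-- Distance zero between distinct indices is allowed: families may repeat points, and gluing along a
-- set puts the two copies of each of its points at distance zero.
record IsPseudoMetric {I : Set} (ρ : I → I → ℝ) : Set where
  field
    nonNeg : ∀ i j → 0ℝ ≤ ρ i j
    self   : ∀ i → ρ i i ≃ 0ℝ
    sym    : ∀ i j → ρ i j ≃ ρ j i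
    tri    : ∀ i j k → ρ i k ≤ ρ i j + ρ j k

  ρ-cong : ∀ {i i′ j j′} → ρ i i′ ≃ 0ℝ → ρ j j′ ≃ 0ℝ → ρ i j ≃ ρ i′ j′
  ρ-cong {i} {i′} {j} {j′} ii jj = ≤.antisym
    (half ii (≃.trans (sym j′ j) jj)) (half (≃.trans (sym i′ i) ii) jj)
    where
    half : ∀ {i i′ j j′} → ρ i i′ ≃ 0ℝ → ρ j′ j ≃ 0ℝ → ρ i j ≤ ρ i′ j′
    half {i} {i′} {j} {j′} ii jj = begin
      ρ i j                         ≤⟨ tri i i′ j ⟩
      ρ i i′ + ρ i′ j               ≤⟨ +-mono-≤ (≤.reflexive ii) (tri i′ j′ j) ⟩
      0ℝ + (ρ i′ j′ + ρ j′ j)       ≈⟨ +-comm 0ℝ _ ⟩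
      (ρ i′ j′ + ρ j′ j) + 0ℝ       ≈⟨ +-identityʳ _ ⟩
      ρ i′ j′ + ρ j′ j              ≈⟨ +-cong ≃.refl jj ⟩
      ρ i′ j′ + 0ℝ                  ≈⟨ +-identityʳ _ ⟩
      ρ i′ j′                       ∎

  -- Points are identified at distance zero, so no quotient is needed.
  metricSpace : MetricSpace
  metricSpace = record
    { Carrier  = I
    ; _≈_      = λ i j → ρ i j ≃ 0ℝ
    ; d        = ρ
    ; isMetric = record
      { isSemiMetric = record
        { isQuasiSemiMetric = record
          { isPreMetric = record
            { isProtoMetric = record
              { isPartialOrder  = ≤-isPartialOrder
              ; ≈-isEquivalence = record
                { refl  = λ {i} → self i
                ; sym   = λ {i} {j} ij → ≃.trans (sym j i) ij
                ; trans = λ {i} {j} {k} ij jk → ≃.trans (ρ-cong ij (self k)) jk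
                }
              ; cong            = ρ-cong
              ; nonNegative     = λ {i} {j} → nonNeg i j
              }
            ; ≈⇒0 = id
            }
          ; 0⇒≈ = id
          }
        ; sym = sym
        }
      ; triangle = tri
      }
    }

pullback : ∀ {I J : Set} {ρ : I → I → ℝ} (f : J → I) → IsPseudoMetric ρ →
           IsPseudoMetric (λ i j → ρ (f i) (f j))
pullback f isP = record
  { nonNeg = λ i j → nonNeg (f i) (f j)
  ; self   = λ i → self (f i)
  ; sym    = λ i j → sym (f i) (f j)
  ; tri    = λ i j k → tri (f i) (f j) (f k)
  }
  where open IsPseudoMetric isP

module _ (M : MetricSpace) where
  open MetricSpace M
  private module S = Setoid setoid

  realise : Universal M → ∀ {I} → Listing I → {ρ : I → I → ℝ} → IsPseudoMetric ρ →
            Σ[ e ∈ (I → Carrier) ] (∀ i j → d (e i) (e j) ≃ ρ i j)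
  realise universal (is , all-i) isP = Embedding.to e , Embedding.isometric e
    where
    open IsPseudoMetric isP
    e : Embedding metricSpace M
    e = universal metricSpace
      (is , λ i → mk⇔ (λ _ → Any.map (λ { ≡.refl → self i }) (all-i i)) (λ _ → tt))

  -- Homogeneity restated for families. The index inside a membership proof selects the image; two
  -- indices of one point have images at distance zero, because `u` and `v` have the same distances.
  extend : Homogeneous M → ∀ {I} → Listing I → (u v : I → Carrier) →
           (∀ i j → d (u i) (u j) ≃ d (v i) (v j)) →
           Σ[ g ∈ Isometry M M ] (∀ i → g ⟨$⟩ u i ≈ v i)
  extend homogeneous {I} (is , all-i) u v u≃v =
    let g , g-ext = homogeneous (Range u) (Range v) (finite u) (finite v) f
    in g , λ i → g-ext (u i , i , S.refl)
    where
    Range : (I → Carrier) → Pred Carrier 0ℓ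
    Range w x = ∃[ i ] x ≈ w i
    finite : ∀ w → Finite M (Range w)
    finite w = map w is , λ x → mk⇔
      (λ (i , x≈wi) → Anyₚ.map⁺ (lose (all-i i) x≈wi))
      (λ x∈ → Any.satisfied (Anyₚ.map⁻ x∈))
    f : Isometry (Subspace M (Range u)) (Subspace M (Range v))
    f = record
      { to         = λ (x , i , _) → v i , i , S.refl
      ; isometric  = λ (x , i , x≈ui) (y , j , y≈uj) →
          ≃.trans (≃.sym (u≃v i j)) (d-cong (S.sym x≈ui) (S.sym y≈uj))
      ; surjective = λ (y , i , y≈vi) → (u i , i , S.refl) , S.sym y≈vi
      }

-- Truncated free amalgamation

module Classical (em : ExcludedMiddle 0ℓ) where

  ≤-total : ∀ x y → x ≤ y ⊎ y ≤ x
  ≤-total x y with <-or-≥ em x y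
  ... | inj₁ x<y = inj₁ (<⇒≤ x<y)
  ... | inj₂ y≤x = inj₂ y≤x

  ℝ-totalOrder : TotalOrder 0ℓ 0ℓ 0ℓ
  ℝ-totalOrder = record
    { isTotalOrder = record { isPartialOrder = ≤-isPartialOrder ; total = ≤-total } }

  private module Ext = Extrema ℝ-totalOrder

  abstract
    -- The first argument is both a cap and the value at the empty list.
    min : ℝ → List ℝ → ℝ
    min = Ext.min

    min-attained : ∀ R xs → min R xs ≡ R ⊎ min R xs ∈ₗ xs
    min-attained = Ext.argmin-sel id

    min≤cap : ∀ R xs → min R xs ≤ R
    min≤cap = Ext.min≤⊤

    min≤∈ : ∀ R {xs x} → x ∈ₗ xs → min R xs ≤ x
    min≤∈ R {xs} = All.lookup (Ext.min≤xs R xs)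

    ≤min : ∀ {R xs v} → v ≤ R → (∀ {x} → x ∈ₗ xs → v ≤ x) → v ≤ min R xs
    ≤min v≤R v≤xs = Ext.v≤min⁺ v≤R (All.tabulate v≤xs)

  min-antitone : ∀ R {xs ys} → (∀ {y} → y ∈ₗ ys → ∃[ x ] (x ∈ₗ xs × x ≤ y)) → min R xs ≤ min R ys
  min-antitone R {xs} {ys} h = ≤min (min≤cap R xs)
    λ y∈ → let x , x∈ , x≤y = h y∈ in ≤.trans (min≤∈ R x∈) x≤y

  -- If a minimum on the right is the cap, the right side is at least `R`; hence truncation keeps
  -- triangle inequalities. Otherwise both minima are attained and `h` applies.
  min-subadditive : ∀ R {xs ys zs} → 0ℝ ≤ min R ys → 0ℝ ≤ min R zs →
    (∀ {y z} → y ∈ₗ ys → z ∈ₗ zs → ∃[ x ] (x ∈ₗ xs × x ≤ y + z)) →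
    min R xs ≤ min R ys + min R zs
  min-subadditive R {xs} {ys} {zs} 0≤ys 0≤zs h with min-attained R ys | min-attained R zs
  ... | inj₁ eq | _       = ≤.trans (min≤cap R xs)
    (≡.subst (λ y → R ≤ y + min R zs) (≡.sym eq) (x≤x+y R 0≤zs))
  ... | inj₂ _  | inj₁ eq = ≤.trans (min≤cap R xs)
    (≡.subst (λ z → R ≤ min R ys + z) (≡.sym eq) (x≤y+x R 0≤ys))
  ... | inj₂ y∈ | inj₂ z∈ = let x , x∈ , x≤ = h y∈ z∈ in ≤.trans (min≤∈ R x∈) x≤

  -- Finitely many positive values have a positive minimum, here taken together with 1 to cover the
  -- empty case. This supplies the least gain δ of a move.
  uniform-gap : ∀ {I : Set} {Q : Pred I 0ℓ} {f : I → ℝ} → Listing I → (∀ i → Q i ⊎ 0ℝ < f i) →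
                ∃[ δ ] (0ℝ < δ × (∀ i → Q i ⊎ δ ≤ f i))
  uniform-gap {I} {Q} {f} (is , all-i) h = let δ , δ>0 , δ-ok = go is in δ , δ>0 , λ i → δ-ok (all-i i)
    where
    go : ∀ is → ∃[ δ ] (0ℝ < δ × (∀ {i} → i ∈ₗ is → Q i ⊎ δ ≤ f i))
    go [] = const 1ℚ , 0<1 , λ ()
    go (i ∷ is) with go is | h i
    ... | δ , δ>0 , ok | inj₁ q = δ , δ>0 , λ { (here ≡.refl) → inj₁ q ; (there i∈) → ok i∈ }
    ... | δ , δ>0 , ok | inj₂ fi>0 with ≤-total δ (f i)
    ...   | inj₁ δ≤fi = δ , δ>0 , λ { (here ≡.refl) → inj₂ δ≤fi ; (there i∈) → ok i∈ }
    ...   | inj₂ fi≤δ = f i , fi>0 , λ where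
      (here ≡.refl) → inj₂ ≤.refl
      (there i∈)    → ⊎-map id (≤.trans fi≤δ) (ok i∈)

  upper-bound : (M : MetricSpace) → ∀ {I} → Listing I → (f : I → ∣ M ∣ₘ) →
    ∃[ R ] (0ℝ ≤ R × (∀ i j → MetricSpace.d M (f i) (f j) ≤ R))
  -- Starting the maximum at zero keeps the bound nonnegative even for an empty family.
  upper-bound M {I} Iˡ f = Ext.max 0ℝ ds , Ext.⊥≤max 0ℝ ds , λ i j →
    All.lookup (Ext.xs≤max 0ℝ ds) (∈-map⁺ dist (proj₂ (Iˡ ⊗ Iˡ) (i , j)))
    where
    dist : I × I → ℝ
    dist (i , j) = MetricSpace.d M (f i) (f j)
    ds : List ℝ
    ds = map dist (proj₁ (Iˡ ⊗ Iˡ))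

  module Free (M : MetricSpace) (R : ℝ) (0≤R : 0ℝ ≤ R) where
    open MetricSpace M
    private module S = Setoid setoid

    via : List Carrier → Carrier → Carrier → List ℝ
    via zs x y = map (λ z → d x z + d z y) zs

    -- Written as a minimum over one entry so that it is, by definition, the distance within one
    -- copy of the amalgam below.
    truncated : Carrier → Carrier → ℝ
    truncated x y = min R (d x y ∷ [])

    free : List Carrier → Carrier → Carrier → ℝ
    free zs x y = min R (via zs x y)

    ∈-via : ∀ {zs z} x y → z ∈ₗ zs → d x z + d z y ∈ₗ via zs x y
    ∈-via x y = ∈-map⁺ (λ z → d x z + d z y)

    truncated≃d : ∀ {x y} → d x y ≤ R → truncated x y ≃ d x y
    truncated≃d d≤R = ≤.antisym (min≤∈ R (here ≡.refl)) (≤min d≤R λ { (here ≡.refl) → ≤.refl })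

    free-≤ : ∀ {zs z} x y → z ∈ₗ zs → free zs x y ≤ d x z + d z y
    free-≤ x y z∈ = min≤∈ R (∈-via x y z∈)

    d≤free : ∀ zs {x y} → d x y ≤ R → d x y ≤ free zs x y
    d≤free zs {x} {y} d≤R = ≤min d≤R λ v∈ →
      let z , _ , eq = ∈-map⁻ _ v∈ in ≡.subst (d x y ≤_) (≡.sym eq) (triangle x z y)

    data Attained (zs : List Carrier) (x y : Carrier) : Set where
      at-cap : free zs x y ≡ R → Attained zs x y
      at-via : ∀ {z} → z ∈ₗ zs → free zs x y ≡ d x z + d z y → Attained zs x y

    free-attained : ∀ zs x y → Attained zs x y
    free-attained zs x y with min-attained R (via zs x y)
    ... | inj₁ eq = at-cap eq
    ... | inj₂ v∈ = let z , z∈ , eq = ∈-map⁻ _ v∈ in at-via z∈ eq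

    -- The route through `z` has a second leg of length zero, and no route is shorter than `d x y`.
    -- So amalgamation keeps the distances to the points of `zs`.
    free≃d : ∀ {zs z x y} → z ∈ₗ zs → z ≈ y → d x y ≤ R → free zs x y ≃ d x y
    free≃d {zs} {z} {x} {y} z∈ z≈y d≤R = ≤.antisym
      (begin
        free zs x y    ≤⟨ free-≤ x y z∈ ⟩
        d x z + d z y  ≈⟨ +-cong (d-cong S.refl z≈y) (≈⇒0 z≈y) ⟩
        d x y + 0ℝ     ≈⟨ +-identityʳ _ ⟩
        d x y          ∎)
      (d≤free zs d≤R)

    free-cong : ∀ zs {x x′ y} → (∀ {z} → z ∈ₗ zs → d x z ≃ d x′ z) → free zs x y ≃ free zs x′ y
    free-cong zs eq = ≤.antisym (half eq) (half (≃.sym ∘ eq))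
      where
      half : ∀ {x x′ y} → (∀ {z} → z ∈ₗ zs → d x z ≃ d x′ z) → free zs x y ≤ free zs x′ y
      half {x} {x′} {y} eq = min-antitone R λ v∈ → let z , z∈ , v≡ = ∈-map⁻ _ v∈ in
        d x z + d z y , ∈-via x y z∈ ,
        ≤.trans (+-mono-≤ (≤.reflexive (eq z∈)) ≤.refl) (≤.reflexive (≃.reflexive (≡.sym v≡)))

    -- Two copies of M, the metric truncated at R, amalgamated freely over zs.
    module Amalgam (zs : List Carrier) where

      links : Carrier ⊎ Carrier → Carrier ⊎ Carrier → List ℝ
      links (inj₁ x) (inj₁ y) = d x y ∷ []
      links (inj₁ x) (inj₂ y) = via zs x y
      links (inj₂ x) (inj₁ y) = via zs x y
      links (inj₂ x) (inj₂ y) = d x y ∷ []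

      ρ : Carrier ⊎ Carrier → Carrier ⊎ Carrier → ℝ
      ρ s t = min R (links s t)

      links-nonNeg : ∀ s t {v} → v ∈ₗ links s t → 0ℝ ≤ v
      links-nonNeg = λ where
          (inj₁ x) (inj₁ y) → direct
          (inj₁ x) (inj₂ y) → cross
          (inj₂ x) (inj₁ y) → cross
          (inj₂ x) (inj₂ y) → direct
        where
        direct : ∀ {x y v} → v ∈ₗ d x y ∷ [] → 0ℝ ≤ v
        direct (here ≡.refl) = nonNegative
        cross : ∀ {x y v} → v ∈ₗ via zs x y → 0ℝ ≤ v
        cross v∈ with _ , _ , ≡.refl ← ∈-map⁻ _ v∈ = ≤.trans nonNegative (x≤x+y _ nonNegative)

      ρ-nonNeg : ∀ s t → 0ℝ ≤ ρ s t
      ρ-nonNeg s t = ≤min 0≤R (links-nonNeg s t)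

      ρ-self : ∀ s → ρ s s ≃ 0ℝ
      ρ-self s = ≤.antisym (below-0 s) (ρ-nonNeg s s)
        where
        below-0 : ∀ s → ρ s s ≤ 0ℝ
        below-0 (inj₁ x) = ≤.trans (min≤∈ R (here ≡.refl)) (≤.reflexive (≈⇒0 S.refl))
        below-0 (inj₂ x) = ≤.trans (min≤∈ R (here ≡.refl)) (≤.reflexive (≈⇒0 S.refl))

      links-sym : ∀ s t {v} → v ∈ₗ links t s → ∃[ w ] (w ∈ₗ links s t × w ≤ v)
      links-sym = λ where
          (inj₁ x) (inj₁ y) → direct
          (inj₁ x) (inj₂ y) → cross
          (inj₂ x) (inj₁ y) → cross
          (inj₂ x) (inj₂ y) → direct
        where
        direct : ∀ {x y v} → v ∈ₗ d y x ∷ [] → ∃[ w ] (w ∈ₗ d x y ∷ [] × w ≤ v)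
        direct {x} {y} (here ≡.refl) = _ , here ≡.refl , ≤.reflexive (d-sym x y)
        cross : ∀ {x y v} → v ∈ₗ via zs y x → ∃[ w ] (w ∈ₗ via zs x y × w ≤ v)
        cross {x} {y} v∈ with z , z∈ , ≡.refl ← ∈-map⁻ _ v∈ = _ , ∈-via x y z∈ , ≤.reflexive
          (≃.trans (+-comm _ _) (+-cong (d-sym z y) (d-sym x z)))

      -- Two routes in succession need not form a listed route, but the triangle inequality shortens
      -- them to one. Two crossings return to the starting copy, where the direct route is listed.
      links-triangle : ∀ s t u {v w} → v ∈ₗ links s t → w ∈ₗ links t u →
                       ∃[ m ] (m ∈ₗ links s u × m ≤ v + w)
      links-triangle = λ where
          (inj₁ x) (inj₁ y) (inj₁ z) → direct-direct
          (inj₁ x) (inj₁ y) (inj₂ z) → direct-cross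
          (inj₁ x) (inj₂ y) (inj₁ z) → cross-cross
          (inj₁ x) (inj₂ y) (inj₂ z) → cross-direct
          (inj₂ x) (inj₁ y) (inj₁ z) → cross-direct
          (inj₂ x) (inj₁ y) (inj₂ z) → cross-cross
          (inj₂ x) (inj₂ y) (inj₁ z) → direct-cross
          (inj₂ x) (inj₂ y) (inj₂ z) → direct-direct
        where
        direct-direct : ∀ {x y z v w} → v ∈ₗ d x y ∷ [] → w ∈ₗ d y z ∷ [] →
                        ∃[ m ] (m ∈ₗ d x z ∷ [] × m ≤ v + w)
        direct-direct {x} {y} {z} (here ≡.refl) (here ≡.refl) = _ , here ≡.refl , triangle x y z

        direct-cross : ∀ {x y z v w} → v ∈ₗ d x y ∷ [] → w ∈ₗ via zs y z →
                       ∃[ m ] (m ∈ₗ via zs x z × m ≤ v + w)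
        direct-cross {x} {y} {z} (here ≡.refl) w∈ with a , a∈ , ≡.refl ← ∈-map⁻ _ w∈ =
          _ , ∈-via x z a∈ , (begin
            d x a + d a z            ≤⟨ +-mono-≤ (triangle x y a) ≤.refl ⟩
            (d x y + d y a) + d a z  ≈⟨ +-assoc _ _ _ ⟩
            d x y + (d y a + d a z)  ∎)

        cross-direct : ∀ {x y z v w} → v ∈ₗ via zs x y → w ∈ₗ d y z ∷ [] →
                       ∃[ m ] (m ∈ₗ via zs x z × m ≤ v + w)
        cross-direct {x} {y} {z} v∈ (here ≡.refl) with a , a∈ , ≡.refl ← ∈-map⁻ _ v∈ =
          _ , ∈-via x z a∈ , (begin
            d x a + d a z            ≤⟨ +-mono-≤ ≤.refl (triangle a y z) ⟩
            d x a + (d a y + d y z)  ≈⟨ +-assoc _ _ _ ⟨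
            (d x a + d a y) + d y z  ∎)

        cross-cross : ∀ {x y z v w} → v ∈ₗ via zs x y → w ∈ₗ via zs y z →
                      ∃[ m ] (m ∈ₗ d x z ∷ [] × m ≤ v + w)
        cross-cross {x} {y} {z} v∈ w∈
          with a , _ , ≡.refl ← ∈-map⁻ _ v∈ | b , _ , ≡.refl ← ∈-map⁻ _ w∈ =
          _ , here ≡.refl , ≤.trans (triangle x y z) (+-mono-≤ (triangle x a y) (triangle y b z))

      isPseudoMetric : IsPseudoMetric ρ
      isPseudoMetric = record
        { nonNeg = ρ-nonNeg
        ; self   = ρ-self
        ; sym    = λ s t → ≤.antisym (min-antitone R (links-sym s t)) (min-antitone R (links-sym t s))
        ; tri    = λ s t u → min-subadditive R (ρ-nonNeg s t) (ρ-nonNeg t u) (links-triangle s t u)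
        }

    -- This is the triangle inequality of the amalgam, with `x` in one copy and `y`, `z` in the
    -- other.
    free-lipschitz : ∀ zs x y z → free zs x z ≤ free zs x y + d y z
    free-lipschitz zs x y z = ≤.trans
      (IsPseudoMetric.tri (Amalgam.isPseudoMetric zs) (inj₁ x) (inj₂ y) (inj₂ z))
      (+-mono-≤ ≤.refl (min≤∈ R (here ≡.refl)))

-- Moves by pointwise stabilisers

module Moves (em : ExcludedMiddle 0ℓ) (𝕌 : MetricSpace) (isUrysohn : IsUrysohn 𝕌)
             (R : ℝ) (0≤R : 0ℝ ≤ R) where
  open Classical em
  open MetricSpace 𝕌
  open IsUrysohn isUrysohn
  open Free 𝕌 R 0≤R
  private module S = Setoid setoid

  Fixes : ∀ {I : Set} → Isometry 𝕌 𝕌 → (I → Carrier) → Set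
  Fixes g a = ∀ i → g ⟨$⟩ a i ≈ a i

  Within : ∀ {I J : Set} → (I → Carrier) → (J → Carrier) → Set
  Within a b = ∀ i j → d (a i) (b j) ≤ R

  Within-sym : ∀ {I J} {a : I → Carrier} {b : J → Carrier} → Within a b → Within b a
  Within-sym {a = a} {b} h j i = ≤.trans (≤.reflexive (d-sym (b j) (a i))) (h i j)

  extend-over : ∀ {K I} → Listing K → Listing I → (c c′ : K → Carrier) (a : I → Carrier) →
    (∀ k l → d (c k) (c l) ≃ d (c′ k) (c′ l)) →
    (∀ k i → d (c k) (a i) ≃ d (c′ k) (a i)) →
    Σ[ g ∈ Isometry 𝕌 𝕌 ] (Fixes g a × (∀ k → g ⟨$⟩ c k ≈ c′ k))
  extend-over K I c c′ a cc ca =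
    let g , g-ext = extend 𝕌 homogeneous (K ⊕ I) [ c , a ] [ c′ , a ] λ where
          (inj₁ k) (inj₁ l) → cc k l
          (inj₁ k) (inj₂ i) → ca k i
          (inj₂ i) (inj₁ k) → ≃.trans (d-sym _ _) (≃.trans (ca k i) (d-sym _ _))
          (inj₂ i) (inj₂ j) → ≃.refl
    in g , g-ext ∘ inj₂ , g-ext ∘ inj₁

  -- The part of the amalgam over `a` with `c` in one copy and `a`, `b` in the other is realised in
  -- 𝕌. Homogeneity is used twice: to bring the realised `a`, `b` back to their places, and then to
  -- carry `c` to its realised copy while fixing `a`.
  free-move : ∀ {K I J} → Listing K → (Iˡ : Listing I) → Listing J →
    (c : K → Carrier) (a : I → Carrier) (b : J → Carrier) →
    Within c c → Within c a → Within a a → Within a b → Within b b →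
    Σ[ g ∈ Isometry 𝕌 𝕌 ]
      (Fixes g a × (∀ k j → d (g ⟨$⟩ c k) (b j) ≃ free (map a (proj₁ Iˡ)) (c k) (b j)))
  free-move {K} {I} {J} Kˡ Iˡ@(is , all-i) Jˡ c a b cc ca aa ab bb =
    g , g-fixes , λ k j → ≃.trans (d-cong (g-c k) S.refl) (c′-ab k (inj₂ j))
    where
    zs : List Carrier
    zs = map a is
    open Amalgam zs
    a∪b : I ⊎ J → Carrier
    a∪b = [ a , b ]
    point : K ⊎ (I ⊎ J) → Carrier ⊎ Carrier
    point = [ inj₁ ∘ c , inj₂ ∘ a∪b ]
    realised : Σ[ e ∈ (K ⊎ (I ⊎ J) → Carrier) ] (∀ s t → d (e s) (e t) ≃ ρ (point s) (point t))
    realised = realise 𝕌 universal (Kˡ ⊕ Iˡ ⊕ Jˡ) (pullback point isPseudoMetric)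
    e = proj₁ realised
    e-isometric = proj₂ realised
    within-ab : Within a∪b a∪b
    within-ab (inj₁ i) (inj₁ j) = aa i j
    within-ab (inj₁ i) (inj₂ j) = ab i j
    within-ab (inj₂ i) (inj₁ j) = Within-sym ab i j
    within-ab (inj₂ i) (inj₂ j) = bb i j
    placed : Σ[ h ∈ Isometry 𝕌 𝕌 ] (∀ s → h ⟨$⟩ e (inj₂ s) ≈ a∪b s)
    placed = extend 𝕌 homogeneous (Iˡ ⊕ Jˡ) (e ∘ inj₂) a∪b λ s t →
      ≃.trans (e-isometric (inj₂ s) (inj₂ t)) (truncated≃d (within-ab s t))
    -- Distances among `a` and `b` are at most `R`, so truncation has not changed them.
    h = proj₁ placed
    c′ : K → Carrier
    c′ k = h ⟨$⟩ e (inj₁ k)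
    c′-c′ : ∀ k l → d (c′ k) (c′ l) ≃ d (c k) (c l)
    c′-c′ k l = ≃.trans (Isometry.isometric h _ _)
      (≃.trans (e-isometric (inj₁ k) (inj₁ l)) (truncated≃d (cc k l)))
    c′-ab : ∀ k s → d (c′ k) (a∪b s) ≃ free zs (c k) (a∪b s)
    c′-ab k s = ≃.trans (d-cong S.refl (S.sym (proj₂ placed s)))
      (≃.trans (Isometry.isometric h _ _) (e-isometric (inj₁ k) (inj₂ s)))
    c′-a : ∀ k i → d (c′ k) (a i) ≃ d (c k) (a i)
    c′-a k i = ≃.trans (c′-ab k (inj₁ i)) (free≃d (∈-map⁺ a (all-i i)) S.refl (ca k i))
    moved = extend-over Kˡ Iˡ c c′ a (λ k l → ≃.sym (c′-c′ k l)) (λ k i → ≃.sym (c′-a k i))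
    g = proj₁ moved
    g-fixes = proj₁ (proj₂ moved)
    g-c = proj₂ (proj₂ moved)

  FixesList : List Carrier → Isometry 𝕌 𝕌 → Set
  FixesList es g = ∀ z → z ∈ₗ es → g ⟨$⟩ z ≈ z

  free-invariant : ∀ es {g} → FixesList es g → ∀ x y → free es (g ⟨$⟩ x) y ≃ free es x y
  free-invariant es {g} fix x y = free-cong es λ z∈ →
    ≃.trans (d-cong S.refl (S.sym (fix _ z∈))) (Isometry.isometric g _ _)

  -- The lower bound s stands for the alternating paths that have avoided es so far.
  Level : ∀ {K I : Set} → List Carrier → ℝ → (K → Carrier) → (I → Carrier) → Set
  Level es s c a = ∀ k i →
    d (c k) (a i) ≤ R × (s ≤ d (c k) (a i) ⊎ free es (c k) (a i) ≤ d (c k) (a i))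

  level-0 : ∀ {K I} es {c : K → Carrier} {a : I → Carrier} → Within c a → Level es 0ℝ c a
  level-0 es ca k i = ca k i , inj₁ nonNegative

  -- Once `s` reaches the cap, both alternatives of `Level` bound the distance below by the free
  -- one; the converse is the triangle inequality.
  level-cap : ∀ {K I es s} {c : K → Carrier} {a : I → Carrier} →
    R ≤ s → Level es s c a →
    ∀ k i → d (c k) (a i) ≃ free es (c k) (a i)
  level-cap {es = es} R≤s level k i with level k i
  ... | d≤R , inj₁ s≤d = ≤.antisym (d≤free es d≤R) (≤.trans (min≤cap R _) (≤.trans R≤s s≤d))
  ... | d≤R , inj₂ f≤d = ≤.antisym (d≤free es d≤R) f≤d

  Separated : ∀ {I J : Set} → List Carrier → ℝ → (I → Carrier) → (J → Carrier) → Set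
  Separated es δ a b = ∀ i j → (∃[ z ] (z ∈ₗ es × z ≈ a i × z ≈ b j)) ⊎ δ ≤ d (a i) (b j)

  Separated-sym : ∀ {I J es δ} {a : I → Carrier} {b : J → Carrier} →
    Separated es δ a b → Separated es δ b a
  Separated-sym sep j i with sep i j
  ... | inj₁ (z , z∈ , z≈a , z≈b) = inj₁ (z , z∈ , z≈b , z≈a)
  ... | inj₂ δ≤ = inj₂ (≤.trans δ≤ (≤.reflexive (d-sym _ _)))

  -- After a free move over `a`, a distance to `b j` is either `R` or the length of a path through
  -- some `a i`. Such a path turns at a point of `es`, or has its lower bound raised by δ, or
  -- inherits a comparison with `free es`.
  step : ∀ {K I J es s δ} → Listing K → Listing I → Listing J →
    {c : K → Carrier} (a : I → Carrier) (b : J → Carrier) →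
    (∀ {z} → z ∈ₗ es → ∃[ i ] z ≈ a i) → Separated es δ a b →
    Within c c → Within a a → Within a b → Within b b → Level es s c a →
    Σ[ g ∈ Isometry 𝕌 𝕌 ] (Fixes g a × FixesList es g × Level es (s + δ) (g ⟨$⟩_ ∘ c) b)
  step {es = es} {s} {δ} Kˡ Iˡ@(is , _) Jˡ {c} a b es⊆a sep cc aa ab bb level =
    g , g-fixes , fixes-es , λ k j →
      ≤.trans (≤.reflexive (g-free k j)) (min≤cap R _) ,
      ⊎-map (λ s+δ≤ → ≤.trans s+δ≤ (≤.reflexive (≃.sym (g-free k j))))
            (λ f≤ → ≤.trans (≤.reflexive (free-invariant es {g} fixes-es (c k) (b j)))
                      (≤.trans f≤ (≤.reflexive (≃.sym (g-free k j)))))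
            (raise k j (free-attained (map a is) (c k) (b j)))
    where
    move = free-move Kˡ Iˡ Jˡ c a b cc (λ k i → proj₁ (level k i)) aa ab bb
    g = proj₁ move
    g-fixes = proj₁ (proj₂ move)
    g-free = proj₂ (proj₂ move)
    fixes-es : FixesList es g
    fixes-es z z∈ = let i , z≈ai = es⊆a z∈ in
      S.trans (Isometry.to-cong g z≈ai) (S.trans (g-fixes i) (S.sym z≈ai))
    raise-via : ∀ k i j → (∃[ z ] (z ∈ₗ es × z ≈ a i × z ≈ b j)) ⊎ δ ≤ d (a i) (b j) →
      s ≤ d (c k) (a i) ⊎ free es (c k) (a i) ≤ d (c k) (a i) →
      s + δ ≤ d (c k) (a i) + d (a i) (b j) ⊎
      free es (c k) (b j) ≤ d (c k) (a i) + d (a i) (b j)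
    -- The path turns at a common point, so it is one of the routes that `free es` minimises over.
    raise-via k i j (inj₁ (z , z∈es , z≈ai , _)) _ = inj₂ (≤.trans (free-≤ (c k) (b j) z∈es)
      (≤.reflexive (+-cong (d-cong S.refl z≈ai) (d-cong z≈ai S.refl))))
    raise-via k i j (inj₂ δ≤d) (inj₁ s≤d) = inj₁ (+-mono-≤ s≤d δ≤d)
    -- The comparison with `free es` already held at `a i`, and one more leg preserves it.
    raise-via k i j (inj₂ δ≤d) (inj₂ f≤d) =
      inj₂ (≤.trans (free-lipschitz es (c k) (a i) (b j)) (+-mono-≤ f≤d ≤.refl))
    raise : ∀ k j → Attained (map a is) (c k) (b j) →
      s + δ ≤ free (map a is) (c k) (b j) ⊎ free es (c k) (b j) ≤ free (map a is) (c k) (b j)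
    raise k j (at-cap eq) = inj₂ (≤.trans (min≤cap R _) (≤.reflexive (≃.reflexive (≡.sym eq))))
    raise k j (at-via z∈ eq) = let i , _ , z≡ai = ∈-map⁻ a z∈ in
      ≡.subst (λ v → s + δ ≤ v ⊎ free es (c k) (b j) ≤ v)
        (≡.trans (≡.cong (λ z → d (c k) z + d z (b j)) (≡.sym z≡ai)) (≡.sym eq))
        (raise-via k i j (sep i j) (proj₂ (level k i)))

  -- Alternating moves by the two stabilisers

  module Alternation {I J} (Iˡ : Listing I) (Jˡ : Listing J) (a : I → Carrier) (b : J → Carrier)
    (es : List Carrier) (es⊆a : ∀ {z} → z ∈ₗ es → ∃[ i ] z ≈ a i)
    (es⊆b : ∀ {z} → z ∈ₗ es → ∃[ j ] z ≈ b j)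
    {δ : ℝ} (0<δ : 0ℝ < δ) (sep : Separated es δ a b)
    (aa : Within a a) (ab : Within a b) (bb : Within b b)
    (X Y : Pred (Isometry 𝕌 𝕌) 0ℓ)
    (a⇒X : ∀ g → Fixes g a → g ∈ X) (b⇒Y : ∀ g → Fixes g b → g ∈ Y) where

    private module G = Group (IsoGroup 𝕌)

    Alternating : Pred (Isometry 𝕌 𝕌) 0ℓ
    Alternating = ⟨_,_⟩ {𝕌} X Y

    FixesList-∙ : ∀ h g → FixesList es h → FixesList es g → FixesList es (h G.∙ g)
    FixesList-∙ h g h-es g-es z z∈ = S.trans (Isometry.to-cong h (g-es z z∈)) (h-es z z∈)

    Within-image : ∀ {K} {c : K → Carrier} (g : Isometry 𝕌 𝕌) → Within c c →
      Within (g ⟨$⟩_ ∘ c) (g ⟨$⟩_ ∘ c)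
    Within-image {c = c} g cc k l =
      ≤.trans (≤.reflexive (Isometry.isometric g (c k) (c l))) (cc k l)

    Reaches : ∀ {K} → ℝ → (K → Carrier) → Set
    Reaches s c = Σ[ g ∈ Isometry 𝕌 𝕌 ]
      (g ∈ Alternating × FixesList es g × Level es s (g ⟨$⟩_ ∘ c) a)

    Alternating-∙ : ∀ h g → h ∈ Alternating → g ∈ Alternating → (h G.∙ g) ∈ Alternating
    Alternating-∙ h g = mul {g = h} {h = g}

    -- A move over `a` controls distances to `b`, so a move over `b` must follow to return to `a`.
    -- The gain is 2δ; recording only δ matches the recursion of `n · δ`.
    round : ∀ {K s} → Listing K → {c : K → Carrier} → Within c c → Level es s c a →
      Reaches (δ + s) c
    round {s = s} Kˡ cc level =
      case step Kˡ Iˡ Jˡ a b es⊆a sep cc aa ab bb level of λ (h , h-a , h-es , h-level) →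
      case step Kˡ Jˡ Iˡ b a es⊆b (Separated-sym sep) (Within-image h cc)
             bb (Within-sym ab) aa h-level of λ (k , k-b , k-es , k-level) →
      k G.∙ h ,
      Alternating-∙ k h (gen {g = k} (inj₂ (b⇒Y k k-b))) (gen {g = h} (inj₁ (a⇒X h h-a))) ,
      FixesList-∙ k h k-es h-es ,
      λ l i → map₂ (⊎-map (≤.trans δ+s≤) id) (k-level l i)
      where
      δ+s≤ : δ + s ≤ (s + δ) + δ
      δ+s≤ = ≤.trans (≤.reflexive (+-comm δ s)) (x≤x+y (s + δ) (<⇒≤ 0<δ))

    alternate : ∀ {K} → Listing K → {c : K → Carrier} → Within c c → Within c a →
      ∀ n → Reaches (n · δ) c
    alternate Kˡ cc ca zero = G.ε , unit , (λ _ _ → S.refl) , level-0 es ca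
    alternate Kˡ cc ca (suc n) = case alternate Kˡ cc ca n of λ (g , g∈ , g-es , g-level) →
      case round Kˡ (Within-image g cc) g-level of λ (h , h∈ , h-es , h-level) →
      h G.∙ g , Alternating-∙ h g h∈ g∈ , FixesList-∙ h g h-es g-es , h-level

    -- By the Archimedean property finitely many rounds lift the lower bound to `R`. As `g` fixes
    -- `es`, the resulting distances are expressed by the original `c`.
    independent : ∀ {K} → Listing K → {c : K → Carrier} → Within c c → Within c a →
      Σ[ g ∈ Isometry 𝕌 𝕌 ]
        (g ∈ Alternating × (∀ k i → d (g ⟨$⟩ c k) (a i) ≃ free es (c k) (a i)))
    independent Kˡ {c} cc ca =
      case archimedean R 0<δ of λ (n , R≤nδ) →
      case alternate Kˡ cc ca n of λ (g , g∈ , g-es , level) →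
      g , g∈ , λ k i →
        ≃.trans (level-cap {es = es} R≤nδ level k i) (free-invariant es {g} g-es (c k) (a i))

    -- Both `c` and its image under `p` are made free from `a` over `es`. Since `p` fixes `es`, the
    -- results have equal distances to `a`, so some `f` fixing `a` carries one to the other, and
    -- `h⁻¹ f g` agrees with `p` on `c`.
    same-orbit : ∀ {K} → Listing K → {c : K → Carrier} (p : Isometry 𝕌 𝕌) → FixesList es p →
      Within c c → Within c a → Within (p ⟨$⟩_ ∘ c) a →
      Σ[ q ∈ Isometry 𝕌 𝕌 ] (q ∈ Alternating × (∀ k → q ⟨$⟩ c k ≈ p ⟨$⟩ c k))
    same-orbit Kˡ {c} p p-es cc ca pca =
      case independent Kˡ cc ca of λ (g , g∈ , g-free) →
      case independent Kˡ (Within-image p cc) pca of λ (h , h∈ , h-free) →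
      case extend-over Kˡ Iˡ (g ⟨$⟩_ ∘ c) (h ⟨$⟩_ ∘ (p ⟨$⟩_) ∘ c) a
             (λ k l → ≃.trans (Isometry.isometric g _ _) (≃.sym
               (≃.trans (Isometry.isometric h _ _) (Isometry.isometric p _ _))))
             (λ k i → ≃.trans (g-free k i) (≃.sym
               (≃.trans (h-free k i) (free-invariant es {p} p-es (c k) (a i))))) of
        λ (f , f-a , f-gc) →
      h G.⁻¹ G.∙ (f G.∙ g) ,
      Alternating-∙ (h G.⁻¹) (f G.∙ g) (inv {g = h} h∈) (Alternating-∙ f g (gen {g = f} (inj₁ (a⇒X f f-a))) g∈) ,
      λ k → S.trans (Isometry.to-cong (h G.⁻¹) (f-gc k))
                    (Isometry.to-injective h (Isometry.to-from h _))

-- Finite subsets of the Urysohn space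

theorem4p16 : ExcludedMiddle 0ℓ →
    (𝕌 : MetricSpace) → IsUrysohn 𝕌 →
    (A B : Pred ∣ 𝕌 ∣ₘ 0ℓ) → Finite 𝕌 A → Finite 𝕌 B →
    (p : Isometry 𝕌 𝕌) → p ∈ Iso 𝕌 (A ∩ B) →
    (C : Pred ∣ 𝕌 ∣ₘ 0ℓ) → Finite 𝕌 C →
    Σ[ q ∈ Isometry 𝕌 𝕌 ]
    (q ∈ ⟨ Iso 𝕌 A , Iso 𝕌 B ⟩) ×
    (∀ x → x ∈ C → let open MetricSpace 𝕌 in q ⟨$⟩ x ≈ p ⟨$⟩ x)
theorem4p16 em 𝕌 isUrysohn A B (as , A⇔as) (bs , B⇔bs) p p∈ C (cs , C⇔cs) =
  -- One bound for the distances among C, p(C), A and B yields every `Within` hypothesis below.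
  case Classical.upper-bound em 𝕌 ((Kˡ ⊕ Kˡ) ⊕ (Iˡ ⊕ Jˡ)) [ [ c , p ⟨$⟩_ ∘ c ] , [ a , b ] ] of
    λ (R , 0≤R , ≤R) →
  case Classical.uniform-gap em (Iˡ ⊗ Jˡ) meet-or-apart of λ (δ , 0<δ , sep) →
  case Moves.Alternation.same-orbit em 𝕌 isUrysohn R 0≤R Iˡ Jˡ a b es es⊆a es⊆b 0<δ (λ i j → sep (i , j))
         (λ i j → ≤R (inj₂ (inj₁ i)) (inj₂ (inj₁ j)))
         (λ i j → ≤R (inj₂ (inj₁ i)) (inj₂ (inj₂ j)))
         (λ i j → ≤R (inj₂ (inj₂ i)) (inj₂ (inj₂ j)))
         (Iso 𝕌 A) (Iso 𝕌 B) (λ g → fixes⇒Iso g as A⇔as) (λ g → fixes⇒Iso g bs B⇔bs)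
         Kˡ p p-es
         (λ k l → ≤R (inj₁ (inj₁ k)) (inj₁ (inj₁ l)))
         (λ k i → ≤R (inj₁ (inj₁ k)) (inj₂ (inj₁ i)))
         (λ k i → ≤R (inj₁ (inj₂ k)) (inj₂ (inj₁ i))) of
    λ (q , q∈ , q≈p) →
  q ,
  q∈ ,
  λ x x∈C → let k , x≈ck = ∈⇒lookup cs C⇔cs x x∈C in
    S.trans (Isometry.to-cong q x≈ck) (S.trans (q≈p k) (Isometry.to-cong p (S.sym x≈ck)))
  where
  open MetricSpace 𝕌
  module S = Setoid setoid
  open SetoidMembership setoid using () renaming (_∈_ to _∈ₛ_)

  Iˡ : Listing (Fin (length as))
  Iˡ = listing-Fin _
  Jˡ : Listing (Fin (length bs))
  Jˡ = listing-Fin _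
  Kˡ : Listing (Fin (length cs))
  Kˡ = listing-Fin _
  a : Fin (length as) → Carrier
  a = lookup as
  b : Fin (length bs) → Carrier
  b = lookup bs
  c : Fin (length cs) → Carrier
  c = lookup cs

  ∈⇒lookup : ∀ {X : Pred Carrier 0ℓ} xs → (∀ x → x ∈ X ⇔ x ∈ₛ xs) →
             ∀ x → x ∈ X → ∃[ i ] x ≈ lookup xs i
  ∈⇒lookup xs X⇔xs x x∈X = let x∈xs = Equivalence.to (X⇔xs x) x∈X in
    Any.index x∈xs , Anyₚ.lookup-index x∈xs

  fixes⇒Iso : ∀ g {X : Pred Carrier 0ℓ} xs → (∀ x → x ∈ X ⇔ x ∈ₛ xs) →
              (∀ i → g ⟨$⟩ lookup xs i ≈ lookup xs i) → g ∈ Iso 𝕌 X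
  fixes⇒Iso g xs X⇔xs fix x x∈X = let i , x≈ = ∈⇒lookup xs X⇔xs x x∈X in
    S.trans (Isometry.to-cong g x≈) (S.trans (fix i) (S.sym x≈))

  ∈B? : ∀ x → Dec (x ∈ B)
  ∈B? x = em
  -- The entries of `as` lying in B represent A ∩ B up to `≈`.
  es : List Carrier
  es = filter ∈B? as
  es∈A : ∀ {z} → z ∈ₗ es → z ∈ A
  es∈A z∈ = Equivalence.from (A⇔as _) (Any.map S.reflexive (proj₁ (∈-filter⁻ ∈B? z∈)))
  es∈B : ∀ {z} → z ∈ₗ es → z ∈ B
  es∈B z∈ = proj₂ (∈-filter⁻ ∈B? {xs = as} z∈)
  es⊆a : ∀ {z} → z ∈ₗ es → ∃[ i ] z ≈ a i
  es⊆a z∈ = ∈⇒lookup as A⇔as _ (es∈A z∈)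
  es⊆b : ∀ {z} → z ∈ₗ es → ∃[ j ] z ≈ b j
  es⊆b z∈ = ∈⇒lookup bs B⇔bs _ (es∈B z∈)
  p-es : ∀ z → z ∈ₗ es → p ⟨$⟩ z ≈ z
  p-es z z∈ = p∈ z (es∈A z∈ , es∈B z∈)

  meet-or-apart : ∀ ij → (∃[ z ] (z ∈ₗ es × z ≈ a (proj₁ ij) × z ≈ b (proj₂ ij))) ⊎
                         0ℝ < d (a (proj₁ ij)) (b (proj₂ ij))
  meet-or-apart (i , j) with <-or-≥ em 0ℝ (d (a i) (b j))
  ... | inj₁ 0<d = inj₂ 0<d
  ... | inj₂ d≤0 = inj₁ (a i , ∈-filter⁺ ∈B? (∈-lookup {xs = as} i) ai∈B , S.refl , ai≈bj)
    where
    ai≈bj : a i ≈ b j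
    ai≈bj = 0⇒≈ (≤.antisym d≤0 nonNegative)
    ai∈B : a i ∈ B
    -- Membership in B amounts to being `≈` to an entry of `bs`, so it passes from `b j` to `a i`.
    ai∈B = Equivalence.from (B⇔bs _)
      (Any.map (λ { ≡.refl → ai≈bj }) (∈-lookup j))
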